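{- For every $a \in \mathbb{N}$ and every integer $b \ge 2$, $R_\mathrm{ord}(S_a^\mathrm{sc}, C_b^\mathrm{mon}) = 1 + (a-1)(b-1)$.
   Context: All graphs are finite, simple and undirected, and a graph of order $n$ has vertex set $\{0,1,\ldots,n-1\}$; $K_n$ is the complete graph on $\{0,\ldots,n-1\}$. A $2$-edge-coloring of $K_n$ assigns each edge a color in $\{1,2\}$. For a graph $H$ and such a coloring, an embedding of $H$ in color $j$ is an injective map $\varphi\colon V(H)\to V(K_n)$ such that for every edge $uv$ of $H$ the edge $\{\varphi(u),\varphi(v)\}$ has color $j$; it is increasing if $\varphi(0)<\cdots<\varphi(|H|-1)$. The ordered Ramsey number $R_\mathrm{ord}(H_1,H_2)$ is the smallest $n$ such that every $2$-edge-coloring of $K_n$ admits an increasing embedding of $H_1$ in color $1$ or an increasing embedding of $H_2$ in color $2$. The start-central star $S_n^\mathrm{sc}$ is the graph of order $n$ whose edges are exactly $\{0,v\}$ for $1\le v\le n-1$. For $n\ge3$ the monotone cycle $C_n^\mathrm{mon}$ has edges $\{i,i+1\}$ ($0\le i\le n-2$) and $\{0,n-1\}$; by convention $C_2^\mathrm{mon}=K_2$. -}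

module Defs where

open import Data.Nat.Base using (ℕ; suc; _≤_; s≤s)
open import Data.Nat.Properties using (1+n≢n)
open import Data.Fin.Base using (Fin; toℕ; _<_)
open import Data.Product.Base using (_×_; _,_; Σ-syntax)
open import Data.Sum.Base using (_⊎_; inj₁; inj₂)
open import Function.Definitions using (Injective)
open import Level using (0ℓ)
open import Relation.Binary.Core using (Rel; _Preserves_⟶_)
open import Relation.Binary.Definitions using (Symmetric; Irreflexive)
open import Relation.Binary.Construct.Closure.Symmetric using (SymClosure; fwd; bwd; symmetric)
open import Relation.Binary.PropositionalEquality.Core using (_≡_; _≢_; refl; sym; ≢-sym)

record Graph (n : ℕ) : Set₁ where
  field
    Adj    : Rel (Fin n) 0ℓ
    symm   : Symmetric Adj
    irrefl : Irreflexive _≡_ Adj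

fromEdges : ∀ {n} (E : Rel (Fin n) 0ℓ) → Irreflexive _≡_ E → Graph n
fromEdges E irr = record
  { Adj    = SymClosure E
  ; symm   = symmetric E
  ; irrefl = λ { refl (fwd e) → irr refl e ; refl (bwd e) → irr refl e }
  }

K : (n : ℕ) → Graph n
K n = record { Adj = _≢_ ; symm = ≢-sym ; irrefl = λ u≡v u≢v → u≢v u≡v }

data Color : Set where
  color₁ color₂ : Color

-- A 2-edge-coloring of K n.  The values on the diagonal carry no meaning: they
-- are never inspected by an embedding, which is injective on a loopless graph.
record Coloring (n : ℕ) : Set where
  field
    color     : Fin n → Fin n → Color
    color-sym : ∀ u v → color u v ≡ color v u

record IsEmbedding {k n : ℕ} (H : Graph k) (c : Coloring n) (j : Color)
                   (φ : Fin k → Fin n) : Set where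
  open Graph H
  open Coloring c
  field
    injective : Injective _≡_ _≡_ φ
    colored   : ∀ {u v} → Adj u v → color (φ u) (φ v) ≡ j

Increasing : ∀ {k n} → (Fin k → Fin n) → Set
Increasing φ = φ Preserves _<_ ⟶ _<_

HasIncreasingEmbedding : ∀ {k n} → Graph k → Coloring n → Color → Set
HasIncreasingEmbedding {k} {n} H c j =
  Σ[ φ ∈ (Fin k → Fin n) ] IsEmbedding H c j φ × Increasing φ

OrdArrows : ∀ {k l} → ℕ → Graph k → Graph l → Set
OrdArrows n H₁ H₂ = (c : Coloring n) →
  HasIncreasingEmbedding H₁ c color₁ ⊎ HasIncreasingEmbedding H₂ c color₂

-- IsOrdRamsey H₁ H₂ n says R_ord(H₁, H₂) = n, existence of the minimum included.
IsOrdRamsey : ∀ {k l} → Graph k → Graph l → ℕ → Set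
IsOrdRamsey H₁ H₂ n = OrdArrows n H₁ H₂ × (∀ m → OrdArrows m H₁ H₂ → n ≤ m)

Ssc : (n : ℕ) → Graph n
Ssc n = fromEdges (λ u v → toℕ u ≡ 0 × 1 ≤ toℕ v) irr
  where
  irr : Irreflexive _≡_ (λ (u v : Fin n) → toℕ u ≡ 0 × 1 ≤ toℕ v)
  irr {u} refl (u≡0 , 1≤u) with toℕ u
  irr refl (refl , ()) | .0

CycleEdge : ∀ n → Rel (Fin n) 0ℓ
CycleEdge n u v = toℕ v ≡ suc (toℕ u) ⊎ (toℕ u ≡ 0 × suc (toℕ v) ≡ n)

Cmon : (n : ℕ) → 2 ≤ n → Graph n
Cmon 0 ()
Cmon 1 (s≤s ())
Cmon 2 _ = K 2
Cmon n@(suc (suc (suc _))) _ = fromEdges (CycleEdge n) irr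
  where
  irr : Irreflexive _≡_ (CycleEdge n)
  irr refl (inj₁ u≡1+u) = 1+n≢n (sym u≡1+u)
  irr {u} refl (inj₂ (u≡0 , 1+u≡n)) with toℕ u
  irr refl (inj₂ (refl , ())) | .0

{-# OPTIONS --safe #-}
-- Upper bound: in a set of 1 + q p vertices with least vertex x, either p of the
-- others are joined to x in color 1, which gives a star, or at least 1 + (q - 1) p
-- of them are joined to x in color 2, and one continues inside those.  This even
-- produces an increasing clique of order b in color 2.
-- Lower bound: cut at most (a - 1)(b - 1) vertices into b - 1 consecutive blocks of
-- at most a - 1 vertices, with color 1 inside the blocks and color 2 between them.
module Submission where

open import Data.Nat.Base using (ℕ; zero; suc; _+_; _*_; _∸_; _≤_; NonZero; s≤s; s<s⁻¹)
import Data.Nat.Base as ℕ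
open import Data.Nat.Properties
open import Data.Nat.DivMod using (_/_; n/n≡1; /-monoˡ-≤; m<n*o⇒m/o<n; +-distrib-/-∣ʳ)
open import Data.Nat.Divisibility using (∣-refl)
open import Data.Fin.Base using (Fin; zero; suc; toℕ; fromℕ; inject₁; inject≤; _<_)
import Data.Fin.Properties as Fin
open import Data.List.Base using (List; []; _∷_; length; lookup; filter; allFin)
open import Data.List.Properties using (length-tabulate)
open import Data.List.Membership.Propositional.Properties using (∈-lookup)
open import Data.List.Relation.Binary.Subset.Propositional using (_⊆_)
open import Data.List.Relation.Binary.Subset.Propositional.Properties using (⊆-trans; filter-⊆; ∷⁺ʳ; All-resp-⊇)
open import Data.List.Relation.Unary.All as All using (All; []; _∷_)
import Data.List.Relation.Unary.All.Properties as All
open import Data.List.Relation.Unary.AllPairs as AllPairs using (AllPairs; []; _∷_)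
import Data.List.Relation.Unary.AllPairs.Properties as AllPairs
open import Data.Product.Base using (_×_; _,_; proj₁; proj₂; Σ-syntax)
open import Data.Sum.Base using (_⊎_; inj₁; inj₂; map₂)
open import Function.Base using (id; _∘_)
open import Level using (Level)
open import Relation.Binary.Construct.Closure.Symmetric using (fwd; bwd)
open import Relation.Binary.Core using (Rel)
open import Relation.Binary.Definitions using (DecidableEquality; tri<; tri≈; tri>)
open import Relation.Binary.PropositionalEquality
open import Relation.Nullary using (¬_; yes; no; contradiction)
open import Relation.Nullary.Decidable using (¬?)
open import Relation.Unary using (Pred; Decidable)
open import Defs

private
  variable
    a ℓ : Level
    A : Set a

lookup-AllPairs : {R : Rel A ℓ} {xs : List A} → AllPairs R xs →
                  ∀ {i j} → i < j → R (lookup xs i) (lookup xs j)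
lookup-AllPairs (Rx ∷ _)   {zero}  {suc j} _   = All.lookup Rx (∈-lookup j)
lookup-AllPairs (_  ∷ Rxs) {suc i} {suc j} i<j = lookup-AllPairs Rxs (s<s⁻¹ i<j)

length-filter-∁ : {P : Pred A ℓ} (P? : Decidable P) (xs : List A) →
                  length (filter P? xs) + length (filter (¬? ∘ P?) xs) ≡ length xs
length-filter-∁ P? []       = refl
length-filter-∁ P? (x ∷ xs) with P? x
... | yes _ = cong suc (length-filter-∁ P? xs)
... | no  _ = trans (+-suc _ _) (cong suc (length-filter-∁ P? xs))

inject≤-mono-< : ∀ {k n} (k≤n : k ≤ n) {i j : Fin k} → i < j → inject≤ i k≤n < inject≤ j k≤n
inject≤-mono-< k≤n {i} {j} i<j =
  subst₂ ℕ._<_ (sym (Fin.toℕ-inject≤ i k≤n)) (sym (Fin.toℕ-inject≤ j k≤n)) i<j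

-- Each of the `k` steps gains at least 1. The lower bound needs this for the positions of the
-- vertices of a star and for the block numbers along a path.
increasing⇒≥ : ∀ {k} (f : Fin (suc k) → ℕ) → (∀ i → f (inject₁ i) ℕ.< f (suc i)) →
               f zero + k ≤ f (fromℕ k)
increasing⇒≥ {zero}  f f< = ≤-reflexive (+-identityʳ _)
increasing⇒≥ {suc k} f f< = begin
  f zero + suc k   ≡⟨ +-suc (f zero) k ⟩
  suc (f zero) + k ≤⟨ +-monoˡ-≤ k (f< zero) ⟩
  f (suc zero) + k ≤⟨ increasing⇒≥ (f ∘ suc) (f< ∘ suc) ⟩
  f (fromℕ (suc k)) ∎
  where open ≤-Reasoning

_≟ᶜ_ : DecidableEquality Color
color₁ ≟ᶜ color₁ = yes refl
color₁ ≟ᶜ color₂ = no λ ()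
color₂ ≟ᶜ color₁ = no λ ()
color₂ ≟ᶜ color₂ = yes refl

≢color₁⇒≡color₂ : ∀ {j} → j ≢ color₁ → j ≡ color₂
≢color₁⇒≡color₂ {color₁} j≢₁ = contradiction refl j≢₁
≢color₁⇒≡color₂ {color₂} _   = refl

module _ {n : ℕ} (c : Coloring n) where
  open Coloring c

  -- Strict monotonicity gives injectivity, and the symmetry of `Adj` and `color` reduces every edge
  -- to the case `u < v`.
  increasing-embedding : ∀ {k} (H : Graph k) {j} (φ : Fin k → Fin n) → Increasing φ →
                         (∀ {u v} → u < v → Graph.Adj H u v → color (φ u) (φ v) ≡ j) →
                         HasIncreasingEmbedding H c j
  increasing-embedding H φ φ-inc φ-col = φ , record { injective = inj ; colored = col } , φ-inc
    where
    open Graph H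
    inj : ∀ {u v} → φ u ≡ φ v → u ≡ v
    inj {u} {v} φu≡φv with Fin.<-cmp u v
    ... | tri< u<v _ _ = contradiction φu≡φv (Fin.<⇒≢ (φ-inc u<v))
    ... | tri≈ _ u≡v _ = u≡v
    ... | tri> _ _ v<u = contradiction (sym φu≡φv) (Fin.<⇒≢ (φ-inc v<u))

    col : ∀ {u v} → Adj u v → color (φ u) (φ v) ≡ _
    col {u} {v} uv with Fin.<-cmp u v
    ... | tri< u<v _ _ = φ-col u<v uv
    ... | tri≈ _ u≡v _ = contradiction uv (irrefl u≡v)
    ... | tri> _ _ v<u = trans (color-sym (φ u) (φ v)) (φ-col v<u (symm uv))

  -- With the order built into the relation, `lookup` enumerates the clique as an increasing map.
  Clique : Color → List (Fin n) → Set
  Clique j = AllPairs (λ u v → u < v × color u v ≡ j)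

  clique-embedding : ∀ {k j} (H : Graph k) {ys} → k ≤ length ys → Clique j ys →
                     HasIncreasingEmbedding H c j
  clique-embedding H {ys} k≤ clique = increasing-embedding H (λ i → lookup ys (inject≤ i k≤))
    (λ u<v → proj₁ (lookup-AllPairs clique (inject≤-mono-< k≤ u<v)))
    (λ u<v _ → proj₂ (lookup-AllPairs clique (inject≤-mono-< k≤ u<v)))

  star-embedding : ∀ {p j x} {ys} → p ≤ length ys → AllPairs _<_ (x ∷ ys) →
                   All (λ y → color x y ≡ j) ys → HasIncreasingEmbedding (Ssc (suc p)) c j
  star-embedding {p} {j} {x} {ys} p≤ sorted joined = increasing-embedding (Ssc (suc p)) φ
    (λ u<v → lookup-AllPairs sorted (inject≤-mono-< (s≤s p≤) u<v)) col
    where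
    φ : Fin (suc p) → Fin n
    φ i = lookup (x ∷ ys) (inject≤ i (s≤s p≤))

    col : ∀ {u v} → u < v → Graph.Adj (Ssc (suc p)) u v → color (φ u) (φ v) ≡ j
    col {zero}  {suc v} _ _ = All.lookup joined (∈-lookup (inject≤ v p≤))
    col {suc _} {suc _} _ (fwd (() , _))
    col {suc _} {suc _} _ (bwd (() , _))

  -- Induction on `q`. The inclusion `ys ⊆ xs` is carried along for `extend`: `x` lies below all of
  -- `rest` and is joined to it in color 2, and the inclusion passes both facts to the clique found
  -- there.
  star-or-clique : ∀ p q xs → AllPairs _<_ xs → suc (q * p) ≤ length xs →
                   HasIncreasingEmbedding (Ssc (suc p)) c color₁ ⊎
                   Σ[ ys ∈ List (Fin n) ] suc q ≤ length ys × ys ⊆ xs × Clique color₂ ys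
  star-or-clique p zero    (x ∷ _) _ _ =
    inj₂ (x ∷ [] , ≤-refl , ∷⁺ʳ x (λ ()) , [] ∷ [])
  star-or-clique p (suc q) (x ∷ xs) (x< ∷ sorted) (s≤s len)
    with p ≤? length (filter (λ y → color x y ≟ᶜ color₁) xs)
  ... | yes p≤ = inj₁ (star-embedding p≤ (All.filter⁺ _ x< ∷ AllPairs.filter⁺ _ sorted) (All.all-filter _ xs))
  ... | no  p≰ = map₂ extend (star-or-clique p q rest (AllPairs.filter⁺ _ sorted) rest-large)
    where
    joined₁? : Decidable (λ y → color x y ≡ color₁)
    joined₁? y = color x y ≟ᶜ color₁

    rest : List (Fin n)
    rest = filter (¬? ∘ joined₁?) xs

    rest-large : suc (q * p) ≤ length rest
    rest-large = +-cancelˡ-≤ (length (filter joined₁? xs)) _ _ (begin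
      length (filter joined₁? xs) + suc (q * p)   ≡⟨ +-suc _ (q * p) ⟩
      -- Removing `x` has used up the `suc` of the hypothesis; the strict bound from `p≰` gives one
      -- back to `rest`.
      suc (length (filter joined₁? xs)) + q * p   ≤⟨ +-monoˡ-≤ (q * p) (≰⇒> p≰) ⟩
      p + q * p                                   ≤⟨ len ⟩
      length xs                                   ≡⟨ length-filter-∁ joined₁? xs ⟨
      length (filter joined₁? xs) + length rest   ∎)
      where open ≤-Reasoning

    extend : Σ[ ys ∈ List (Fin n) ] suc q ≤ length ys × ys ⊆ rest × Clique color₂ ys →
             Σ[ ys ∈ List (Fin n) ] suc (suc q) ≤ length ys × ys ⊆ x ∷ xs × Clique color₂ ys
    extend (ys , q< , ys⊆rest , clique) =
      x ∷ ys , s≤s q< , ∷⁺ʳ x (⊆-trans ys⊆rest (filter-⊆ _ xs)) ,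
      All-resp-⊇ ys⊆rest
        (All.zip (All.filter⁺ _ x< , All.map ≢color₁⇒≡color₂ (All.all-filter (¬? ∘ joined₁?) xs)))
      ∷ clique

-- The second graph is arbitrary, since a clique of order `suc q` contains every graph of that order
-- in increasing position.
arrows : ∀ p q (H : Graph (suc q)) → OrdArrows (suc (q * p)) (Ssc (suc p)) H
arrows p q H c = map₂ (λ (_ , len , _ , clique) → clique-embedding c H len clique)
  (star-or-clique c p q (allFin _) (AllPairs.tabulate⁺-< id) (≤-reflexive (sym (length-tabulate id))))

-- The quotient by `p` serves as the block number, so blocks are intervals of length `p`, the last
-- one possibly shorter.
block-coloring : ∀ m p .{{_ : NonZero p}} → Coloring m
block-coloring m p = record { color = col ; color-sym = col-sym }
  where
  col : Fin m → Fin m → Color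
  col u v with toℕ u / p ≟ toℕ v / p
  ... | yes _ = color₁
  ... | no  _ = color₂

  col-sym : ∀ u v → col u v ≡ col v u
  col-sym u v with toℕ u / p ≟ toℕ v / p | toℕ v / p ≟ toℕ u / p
  ... | yes _  | yes _  = refl
  ... | yes eq | no neq = contradiction (sym eq) neq
  ... | no neq | yes eq = contradiction (sym eq) neq
  ... | no _   | no _   = refl

module _ (m p : ℕ) .{{_ : NonZero p}} where
  open Coloring (block-coloring m p)

  color₁⇒same-block : ∀ u v → color u v ≡ color₁ → toℕ u / p ≡ toℕ v / p
  color₁⇒same-block u v eq with toℕ u / p ≟ toℕ v / p
  ... | yes same = same

  color₂⇒different-block : ∀ u v → color u v ≡ color₂ → toℕ u / p ≢ toℕ v / p
  color₂⇒different-block u v eq with toℕ u / p ≟ toℕ v / p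
  ... | no different = different

  -- The edge from the center to the last leaf is enough: its ends are at least `p` apart, so their
  -- quotients by `p` differ.
  no-star : ¬ HasIncreasingEmbedding (Ssc (suc p)) (block-coloring m p) color₁
  no-star (φ , emb , φ-inc) = <-irrefl same (begin-strict
    toℕ (φ zero) / p            <⟨ m<m+n _ (≤-reflexive (sym (n/n≡1 p))) ⟩
    toℕ (φ zero) / p + p / p    ≡⟨ +-distrib-/-∣ʳ (toℕ (φ zero)) ∣-refl ⟨
    (toℕ (φ zero) + p) / p      ≤⟨ /-monoˡ-≤ p (increasing⇒≥ (toℕ ∘ φ) (λ i → φ-inc (Fin.≤̄⇒inject₁< ≤-refl))) ⟩
    toℕ (φ (fromℕ p)) / p       ∎)
    where
    open ≤-Reasoning
    same : toℕ (φ zero) / p ≡ toℕ (φ (fromℕ p)) / p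
    same = color₁⇒same-block _ _ (IsEmbedding.colored emb
      (fwd (refl , subst (1 ≤_) (sym (Fin.toℕ-fromℕ p)) (ℕ.>-nonZero⁻¹ p))))

  -- Block numbers never decrease along an increasing map, and an edge of color 2 changes them. So
  -- the `q` edges of the path lead to a block numbered at least `q`, while `m ≤ q * p` leaves only
  -- the numbers below `q`.
  no-monotone-path : ∀ {q} (H : Graph (suc q)) → (∀ i → Graph.Adj H (inject₁ i) (suc i)) →
                     m ≤ q * p → ¬ HasIncreasingEmbedding H (block-coloring m p) color₂
  no-monotone-path {q} H path m≤ (φ , emb , φ-inc) = <-irrefl refl (begin-strict
    q                            ≤⟨ m≤n+m q _ ⟩
    toℕ (φ zero) / p + q         ≤⟨ increasing⇒≥ (λ i → toℕ (φ i) / p) block< ⟩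
    toℕ (φ (fromℕ q)) / p        <⟨ m<n*o⇒m/o<n (≤-trans (Fin.toℕ<n (φ (fromℕ q))) m≤) ⟩
    q                            ∎)
    where
    open ≤-Reasoning
    block< : ∀ i → toℕ (φ (inject₁ i)) / p ℕ.< toℕ (φ (suc i)) / p
    block< i = ≤∧≢⇒<
      (/-monoˡ-≤ p (<⇒≤ (φ-inc (Fin.≤̄⇒inject₁< ≤-refl))))
      (color₂⇒different-block _ _ (IsEmbedding.colored emb (path i)))

Cmon-path : ∀ q (2≤b : 2 ≤ suc q) (i : Fin q) → Graph.Adj (Cmon (suc q) 2≤b) (inject₁ i) (suc i)
Cmon-path zero          _ ()
-- The convention makes this graph `K 2`, whose adjacency is inequality.
Cmon-path (suc zero)    _ zero = λ ()
Cmon-path (suc (suc _)) _ i    = fwd (inj₁ (cong suc (sym (Fin.toℕ-inject₁ i))))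

-- For p = 0 there are no blocks, but then m = 0 and no graph with a vertex embeds.
¬arrows : ∀ p q m (H : Graph (suc q)) → (∀ i → Graph.Adj H (inject₁ i) (suc i)) →
          m ≤ q * p → ¬ OrdArrows m (Ssc (suc p)) H
¬arrows (suc p) q m H path m≤ arr with arr (block-coloring m (suc p))
... | inj₁ star = no-star m (suc p) star
... | inj₂ emb  = no-monotone-path m (suc p) H path m≤ emb
¬arrows zero q m H path m≤ arr with n≤0⇒n≡0 (≤-trans m≤ (≤-reflexive (*-zeroʳ q)))
... | refl with arr (record { color = λ () ; color-sym = λ () })
...   | inj₁ (φ , _) = Fin.¬Fin0 (φ zero)
...   | inj₂ (φ , _) = Fin.¬Fin0 (φ zero)

theorem4p18 : (a b : ℕ) → 1 ≤ a → (2≤b : 2 ≤ b) →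
    IsOrdRamsey (Ssc a) (Cmon b 2≤b) (1 + (a ∸ 1) * (b ∸ 1))
-- The product is turned into `q * p` because the induction on `q` splits off one summand `p` at a
-- time.
theorem4p18 (suc p) (suc q) _ 2≤b rewrite *-comm p q =
  arrows p q (Cmon (suc q) 2≤b) ,
  λ m arr → ≰⇒> (λ m≤ → ¬arrows p q m (Cmon (suc q) 2≤b) (Cmon-path q 2≤b) m≤ arr)
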